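{- For positive integers $X$, let $S(X)=\left\{m : m=\left\lfloor \frac{X}{n}\right\rfloor \text{ for some positive integer } n\le X\right\}$. Then $$|S(X)|=2\sqrt{X}+O(1),$$ that is, there is an absolute constant $C$ such that $\left||S(X)|-2\sqrt{X}\right|\le C$ for every positive integer $X$.
   Context: The variables $m$ and $n$ range over positive integers. For a real number $y$, $\lfloor y\rfloor$ denotes the greatest integer not exceeding $y$. $|S(X)|$ denotes the cardinality of the set $S(X)$ (distinct values are counted once). -}

module Defs where

open import Level using (0ℓ)
open import Data.Empty using (⊥-elim)
open import Data.Integer as ℤ using (+_)
import Data.Integer.Properties as ℤ
open import Data.List using (List; length; map; upTo; deduplicate)
open import Data.List.Membership.Propositional using (_∈_)
open import Data.List.Membership.Propositional.Properties
  using (∈-map⁺; ∈-map⁻; ∈-upTo⁺; ∈-upTo⁻; ∈-deduplicate⁺; ∈-deduplicate⁻)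
open import Data.List.Relation.Unary.Unique.Propositional using (Unique)
import Data.List.Relation.Unary.Unique.DecPropositional.Properties as Unique
open import Data.Nat as ℕ using (ℕ; zero; suc)
import Data.Nat.Coprimality as Coprimality
import Data.Nat.DivMod as ℕ
import Data.Nat.Properties as ℕ
open import Data.Product using (∃; ∃₂; _×_; _,_; map₂)
open import Data.Rational
open import Data.Rational.Properties
import Data.Rational.Unnormalised as ℚᵘ
import Data.Rational.Unnormalised.Properties as ℚᵘ
open import Data.Sum as Sum using (_⊎_; inj₁; inj₂)
open import Function using (_∘_; _⇔_; mk⇔)
open import Relation.Binary using (tri<; tri≈; tri>)
open import Relation.Binary.PropositionalEquality
open import Relation.Nullary using (¬_; yes; no)
open import Relation.Nullary.Decidable using (dec⇒maybe)
open import Relation.Unary using (Pred)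
import Tactic.RingSolver.Core.AlmostCommutativeRing as ACR
open import Tactic.RingSolver using (solve-∀)

-- Two-sided Dedekind cuts: for a real x, L q reads "q < x" and U q reads "x < q".
record ℝ : Set₁ where
  field
    L U         : Pred ℚ 0ℓ
    L-inhabited : ∃ L
    U-inhabited : ∃ U
    L-lower     : ∀ {p q} → p < q → L q → L p
    U-upper     : ∀ {p q} → p < q → U p → U q
    L-open      : ∀ {p} → L p → ∃ λ q → p < q × L q
    U-open      : ∀ {q} → U q → ∃ λ p → p < q × U p
    disjoint    : ∀ {q} → L q → ¬ U q
    located     : ∀ {p q} → p < q → L p ⊎ U q

open ℝ

infix 4 _≤ℝ_

_≤ℝ_ : ℝ → ℝ → Set
x ≤ℝ y = ∀ {q} → L x q → L y q

private

  ℚ-ring : ACR.AlmostCommutativeRing 0ℓ 0ℓ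
  ℚ-ring = ACR.fromCommutativeRing +-*-commutativeRing (λ p → dec⇒maybe (0ℚ ≟ p))

  L-lower-≤ : ∀ x {p q} → p ≤ q → L x q → L x p
  L-lower-≤ x {p} {q} p≤q l with <-cmp p q
  ... | tri< p<q _ _ = L-lower x p<q l
  ... | tri≈ _ refl _ = l
  ... | tri> _ _ q<p = ⊥-elim (<-irrefl refl (<-≤-trans q<p p≤q))

  U-upper-≤ : ∀ x {p q} → p ≤ q → U x p → U x q
  U-upper-≤ x {p} {q} p≤q u with <-cmp p q
  ... | tri< p<q _ _ = U-upper x p<q u
  ... | tri≈ _ refl _ = u
  ... | tri> _ _ q<p = ⊥-elim (<-irrefl refl (<-≤-trans q<p p≤q))

  p<p+ε : ∀ p {ε} → 0ℚ < ε → p < p + ε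
  p<p+ε p {ε} 0<ε = subst (_< p + ε) (+-identityʳ p) (+-monoʳ-< p 0<ε)

  p-ε<p : ∀ p {ε} → 0ℚ < ε → p - ε < p
  p-ε<p p {ε} 0<ε = subst (p - ε <_) (+-identityʳ p) (+-monoʳ-< p (neg-antimono-< 0<ε))

  p<q⇒0<q-p : ∀ {p q} → p < q → 0ℚ < q - p
  p<q⇒0<q-p {p} {q} p<q = subst (_< q - p) (+-inverseʳ p) (+-monoˡ-< (- p) p<q)

  p+[q-p]≡q : ∀ p q → p + (q - p) ≡ q
  p+[q-p]≡q = solve-∀ ℚ-ring

  neg-involutive : ∀ p → - (- p) ≡ p
  neg-involutive = solve-∀ ℚ-ring

  *-mono-<-pos : ∀ {p q r} → 0ℚ < r → p < q → r * p < r * q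
  *-mono-<-pos {r = r} 0<r = *-monoʳ-<-pos r {{positive 0<r}}

  *-mono-≤-nonNeg : ∀ {p q r} → 0ℚ ≤ r → p ≤ q → r * p ≤ r * q
  *-mono-≤-nonNeg {r = r} 0≤r = *-monoˡ-≤-nonNeg r {{nonNegative 0≤r}}

  0<p*q : ∀ {p q} → 0ℚ < p → 0ℚ < q → 0ℚ < p * q
  0<p*q {p} {q} 0<p 0<q = subst (_< p * q) (*-zeroʳ p) (*-mono-<-pos 0<p 0<q)

  square-mono-< : ∀ {p q} → 0ℚ ≤ p → p < q → p * p < q * q
  square-mono-< {p} {q} 0≤p p<q = ≤-<-trans (*-mono-≤-nonNeg 0≤p (<⇒≤ p<q))
    (subst (_< q * q) (*-comm q p) (*-mono-<-pos (≤-<-trans 0≤p p<q) p<q))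

  halve : ∀ {p} → 0ℚ < p → 0ℚ < ½ * p
  halve 0<p = 0<p*q (positive⁻¹ ½) 0<p

  half+half : ∀ p → ½ * p + ½ * p ≡ p
  half+half = solve-∀ ℚ-ring

  half< : ∀ {p} → 0ℚ < p → ½ * p < p
  half< {p} 0<p = subst (½ * p <_) (half+half p) (p<p+ε (½ * p) (halve 0<p))

  recip : ∀ p → 0ℚ < p → ∃ λ r → 0ℚ < r × r * p ≡ 1ℚ
  recip p 0<p = 1/ p , positive⁻¹ _ {{1/pos⇒pos p}} , *-inverseˡ p
    where instance _ = positive 0<p
                   _ = pos⇒nonZero p

  ι : ℕ → ℚ
  ι n = mkℚ (+ n) 0 (Coprimality.sym (Coprimality.1-coprimeTo n))

  ι-suc : ∀ n → ι (suc n) ≡ 1ℚ + ι n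
  ι-suc n = toℚᵘ-injective (ℚᵘ.≃-trans (ℚᵘ.*≡* eq) (ℚᵘ.≃-sym (toℚᵘ-homo-+ 1ℚ (ι n))))
    where
    eq : + suc n ℤ.* + 1 ≡ (+ 1 ℤ.* + 1 ℤ.+ + n ℤ.* + 1) ℤ.* + 1
    eq = cong (ℤ._* + 1) (cong (λ z → + 1 ℤ.+ z) (sym (ℤ.*-identityʳ (+ n))))

  ≤ι : ∀ p → ∃ λ n → p ≤ ι n
  ≤ι p@(mkℚ (+ n) d _) = n , *≤* (subst₂ ℤ._≤_ (ℤ.pos-* n 1) (ℤ.pos-* n (suc d))
    (ℤ.+≤+ (ℕ.*-monoʳ-≤ n (ℕ.s≤s ℕ.z≤n))))
  ≤ι p@(mkℚ ℤ.-[1+ n ] d _) = 0 , <⇒≤ (negative⁻¹ p)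

  advance : ℚ → ℕ → ℚ → ℚ
  advance δ zero    a = a
  advance δ (suc n) a = advance δ n (a + δ)

  advance-≡ : ∀ δ n a → advance δ n a ≡ a + ι n * δ
  advance-≡ δ zero    a = sym (trans (cong (λ z → a + z) (*-zeroˡ δ)) (+-identityʳ a))
  advance-≡ δ (suc n) a = trans (advance-≡ δ n (a + δ)) (trans
    (step a δ (ι n))
    (cong (λ z → a + z * δ) (sym (ι-suc n))))
    where
    step : ∀ a δ n → a + δ + n * δ ≡ a + (1ℚ + n) * δ
    step = solve-∀ ℚ-ring

  archimedean : ∀ {δ} → 0ℚ < δ → ∀ a b → ∃ λ n → b ≤ advance δ n a
  archimedean {δ} 0<δ a b with recip δ 0<δ
  ... | r , 0<r , rδ≡1 with ≤ι (r * (b - a))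
  ... | n , le = n , subst₂ _≤_ lhs (trans (cong (λ z → a + z) (*-comm δ (ι n))) (sym (advance-≡ δ n a)))
                       (+-monoʳ-≤ a (*-mono-≤-nonNeg (<⇒≤ 0<δ) le))
    where
    assoc : ∀ a b r δ → a + δ * (r * (b - a)) ≡ a + (r * δ) * (b - a)
    assoc = solve-∀ ℚ-ring

    cancel : ∀ a b → a + 1ℚ * (b - a) ≡ b
    cancel = solve-∀ ℚ-ring

    lhs : a + δ * (r * (b - a)) ≡ b
    lhs = trans (assoc a b r δ) (trans (cong (λ z → a + z * (b - a)) rδ≡1) (cancel a b))

  walk : ∀ x {δ} → 0ℚ < δ → ∀ n a → L x a → U x (advance δ n a) → ∃ λ a → L x a × U x (a + δ + δ)
  walk x     0<δ zero    a l u = ⊥-elim (disjoint x l u)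
  walk x {δ} 0<δ (suc n) a l u = Sum.[ (λ l′ → walk x 0<δ n (a + δ) l′ u) , (λ u′ → a , l , u′) ]′
    (located x (p<p+ε (a + δ) 0<δ))

  approximate : ∀ x {δ} → 0ℚ < δ → ∃ λ a → L x a × U x (a + δ + δ)
  approximate x 0<δ =
    let a , l = L-inhabited x
        b , u = U-inhabited x
        n , b≤ = archimedean 0<δ a b
    in walk x 0<δ n a l (U-upper-≤ x b≤ u)

  step : ∀ s d c → 0ℚ < s → 0ℚ < d → 0ℚ < c → ∃ λ δ → 0ℚ < δ × δ ≤ c × s * δ ≤ d
  step s d c 0<s 0<d 0<c with recip s 0<s
  ... | r , 0<r , rs≡1 = δ , 0<δ , p⊓q≤q (r * d) c , subst (s * δ ≤_) eq (*-mono-≤-nonNeg (<⇒≤ 0<s) (p⊓q≤p (r * d) c))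
    where
    δ = r * d ⊓ c
    0<δ : 0ℚ < δ
    0<δ with ⊓-sel (r * d) c
    ... | inj₁ e = subst (0ℚ <_) (sym e) (0<p*q 0<r 0<d)
    ... | inj₂ e = subst (0ℚ <_) (sym e) 0<c
    assoc : ∀ r s d → s * (r * d) ≡ (r * s) * d
    assoc = solve-∀ ℚ-ring
    eq : s * (r * d) ≡ d
    eq = trans (assoc r s d) (trans (cong (_* d) rs≡1) (*-identityˡ d))

  ≤square : ∀ u → ∃ λ q → 0ℚ < q × u ≤ q * q
  ≤square u = q , 0<q , ≤-trans (p≤p⊔q u 1ℚ) q≤q²
    where
    q = u ⊔ 1ℚ
    0<q : 0ℚ < q
    0<q = <-≤-trans (positive⁻¹ 1ℚ) (p≤q⊔p u 1ℚ)
    q≤q² : q ≤ q * q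
    q≤q² = subst (_≤ q * q) (*-identityʳ q) (*-mono-≤-nonNeg (<⇒≤ 0<q) (p≤q⊔p u 1ℚ))

  square-below : ∀ p t → 0ℚ ≤ p → p * p < t → ∃ λ q → p < q × q * q ≤ t
  square-below p t 0≤p p²<t =
    let δ , 0<δ , δ≤1 , sδ≤d = step (p + p + 1ℚ) (t - p * p) 1ℚ
          (+-mono-≤-< (+-mono-≤ 0≤p 0≤p) (positive⁻¹ 1ℚ)) (p<q⇒0<q-p p²<t) (positive⁻¹ 1ℚ)
    in p + δ , p<p+ε p 0<δ , bound δ 0<δ δ≤1 sδ≤d
    where
    expand : ∀ p δ → p * p + δ * (p + p + δ) ≡ (p + δ) * (p + δ)
    expand = solve-∀ ℚ-ring
    bound : ∀ δ → 0ℚ < δ → δ ≤ 1ℚ → (p + p + 1ℚ) * δ ≤ t - p * p → (p + δ) * (p + δ) ≤ t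
    bound δ 0<δ δ≤1 sδ≤d = subst₂ _≤_ (expand p δ) (p+[q-p]≡q (p * p) t) (+-monoʳ-≤ (p * p)
      (≤-trans (*-mono-≤-nonNeg (<⇒≤ 0<δ) (+-monoʳ-≤ (p + p) δ≤1))
               (subst (_≤ t - p * p) (*-comm (p + p + 1ℚ) δ) sδ≤d)))

  square-above : ∀ q t → 0ℚ < q → t < q * q → ∃ λ p → p < q × 0ℚ < p × t ≤ p * p
  square-above q t 0<q t<q² =
    let δ , 0<δ , δ≤q/2 , sδ≤d = step (q + q) (q * q - t) (½ * q)
          (+-mono-< 0<q 0<q) (p<q⇒0<q-p t<q²) (halve 0<q)
    in q - δ , p-ε<p q 0<δ , p<q⇒0<q-p (≤-<-trans δ≤q/2 (half< 0<q)) , bound δ 0<δ sδ≤d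
    where
    expand : ∀ q δ → q * q - (q + q) * δ + δ * δ ≡ (q - δ) * (q - δ)
    expand = solve-∀ ℚ-ring
    cancel : ∀ q t → q * q - (q * q - t) + 0ℚ ≡ t
    cancel = solve-∀ ℚ-ring
    bound : ∀ δ → 0ℚ < δ → (q + q) * δ ≤ q * q - t → t ≤ (q - δ) * (q - δ)
    bound δ 0<δ sδ≤d = subst₂ _≤_ (cancel q t) (expand q δ) (+-mono-≤
      (+-monoʳ-≤ (q * q) (neg-antimono-≤ sδ≤d)) (<⇒≤ (0<p*q 0<δ 0<δ)))

fromℚ : ℚ → ℝ
fromℚ r = record
  { L = _< r
  ; U = r <_
  ; L-inhabited = r - 1ℚ , p-ε<p r (positive⁻¹ 1ℚ)
  ; U-inhabited = r + 1ℚ , p<p+ε r (positive⁻¹ 1ℚ)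
  ; L-lower = <-trans
  ; U-upper = λ p<q r<p → <-trans r<p p<q
  ; L-open = <-dense
  ; U-open = λ r<q → let m , r<m , m<q = <-dense r<q in m , m<q , r<m
  ; disjoint = λ q<r r<q → <-irrefl refl (<-trans q<r r<q)
  ; located = loc
  }
  where
  loc : ∀ {p q} → p < q → p < r ⊎ r < q
  loc {p} p<q with p <? r
  ... | yes p<r = inj₁ p<r
  ... | no  p≮r = inj₂ (≤-<-trans (≮⇒≥ p≮r) p<q)

fromℕ : ℕ → ℝ
fromℕ n = fromℚ (+ n / 1)

infix  8 -ℝ_
infixl 6 _+ℝ_ _-ℝ_ _⊔ℝ_
infixr 7 _·_
infix  8 √_

-ℝ_ : ℝ → ℝ
-ℝ x = record
  { L = λ q → U x (- q)
  ; U = λ q → L x (- q)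
  ; L-inhabited = let q , u = U-inhabited x in - q , subst (U x) (sym (neg-involutive q)) u
  ; U-inhabited = let q , l = L-inhabited x in - q , subst (L x) (sym (neg-involutive q)) l
  ; L-lower = λ p<q → U-upper x (neg-antimono-< p<q)
  ; U-upper = λ p<q → L-lower x (neg-antimono-< p<q)
  ; L-open = λ {p} u → let q , q<-p , u′ = U-open x u in
      - q , subst (_< - q) (neg-involutive p) (neg-antimono-< q<-p)
          , subst (U x) (sym (neg-involutive q)) u′
  ; U-open = λ {q} l → let p , -q<p , l′ = L-open x l in
      - p , subst (- p <_) (neg-involutive q) (neg-antimono-< -q<p)
          , subst (L x) (sym (neg-involutive p)) l′
  ; disjoint = λ u l → disjoint x l u
  ; located = λ p<q → Sum.swap (located x (neg-antimono-< p<q))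
  }

_+ℝ_ : ℝ → ℝ → ℝ
x +ℝ y = record
  { L = λ q → ∃₂ λ a b → L x a × L y b × q ≡ a + b
  ; U = λ q → ∃₂ λ a b → U x a × U y b × q ≡ a + b
  ; L-inhabited = let a , l = L-inhabited x ; b , m = L-inhabited y in a + b , a , b , l , m , refl
  ; U-inhabited = let a , u = U-inhabited x ; b , v = U-inhabited y in a + b , a , b , u , v , refl
  ; L-lower = λ { {p} p<q (a , b , l , m , refl) →
      a , p - a , l , L-lower y (subst (p - a <_) (a+b-a a b) (+-monoˡ-< (- a) p<q)) m , sym (p+[q-p]≡q a p) }
  ; U-upper = λ { {p} {q} p<q (a , b , u , v , refl) →
      a , q - a , u , U-upper y (subst (_< q - a) (a+b-a a b) (+-monoˡ-< (- a) p<q)) v , sym (p+[q-p]≡q a q) }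
  ; L-open = λ { (a , b , l , m , refl) → let a′ , a<a′ , l′ = L-open x l in
      a′ + b , +-monoˡ-< b a<a′ , a′ , b , l′ , m , refl }
  ; U-open = λ { (a , b , u , v , refl) → let a′ , a′<a , u′ = U-open x u in
      a′ + b , +-monoˡ-< b a′<a , a′ , b , u′ , v , refl }
  ; disjoint = λ { (a , b , l , m , refl) (c , d , u , v , eq) →
      <-irrefl eq (+-mono-< (L<U x l u) (L<U y m v)) }
  ; located = loc
  }
  where
  a+b-a : ∀ a b → a + b - a ≡ b
  a+b-a = solve-∀ ℚ-ring

  L<U : ∀ z {p q} → L z p → U z q → p < q
  L<U z {p} {q} l u with p <? q
  ... | yes p<q = p<q
  ... | no  p≮q = ⊥-elim (disjoint z l (U-upper-≤ z (≮⇒≥ p≮q) u))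

  split : ∀ a p q → q ≡ (a + ½ * (½ * (q - p)) + ½ * (½ * (q - p))) + ((p - a) + ½ * (q - p))
  split = solve-∀ ℚ-ring

  loc : ∀ {p q} → p < q → (∃₂ λ a b → L x a × L y b × p ≡ a + b)
                        ⊎ (∃₂ λ a b → U x a × U y b × q ≡ a + b)
  loc {p} {q} p<q =
    let 0<ε       = halve (p<q⇒0<q-p p<q)
        a , l , u = approximate x (halve 0<ε)
    in Sum.map (λ m → a , p - a , l , m , sym (p+[q-p]≡q a p))
               (λ v → _ , _ , u , v , split a p q)
               (located y (p<p+ε (p - a) 0<ε))

_-ℝ_ : ℝ → ℝ → ℝ
x -ℝ y = x +ℝ -ℝ y

_⊔ℝ_ : ℝ → ℝ → ℝ
x ⊔ℝ y = record
  { L = λ q → L x q ⊎ L y q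
  ; U = λ q → U x q × U y q
  ; L-inhabited = map₂ inj₁ (L-inhabited x)
  ; U-inhabited = let a , u = U-inhabited x ; b , v = U-inhabited y in
      a ⊔ b , U-upper-≤ x (p≤p⊔q a b) u , U-upper-≤ y (p≤q⊔p a b) v
  ; L-lower = λ p<q → Sum.map (L-lower x p<q) (L-lower y p<q)
  ; U-upper = λ { p<q (u , v) → U-upper x p<q u , U-upper y p<q v }
  ; L-open = λ { (inj₁ l) → map₂ (map₂ inj₁) (L-open x l) ; (inj₂ m) → map₂ (map₂ inj₂) (L-open y m) }
  ; U-open = U-op
  ; disjoint = λ { (inj₁ l) (u , v) → disjoint x l u ; (inj₂ m) (u , v) → disjoint y m v }
  ; located = loc
  }
  where
  U-op : ∀ {q} → U x q × U y q → ∃ λ p → p < q × U x p × U y p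
  U-op (u , v) with U-open x u | U-open y v
  ... | a , a<q , u′ | b , b<q , v′ with ≤-total a b
  ... | inj₁ a≤b = b , b<q , U-upper-≤ x a≤b u′ , v′
  ... | inj₂ b≤a = a , a<q , u′ , U-upper-≤ y b≤a v′

  loc : ∀ {p q} → p < q → (L x p ⊎ L y p) ⊎ (U x q × U y q)
  loc p<q with located x p<q | located y p<q
  ... | inj₁ l | _      = inj₁ (inj₁ l)
  ... | inj₂ u | inj₁ m = inj₁ (inj₂ m)
  ... | inj₂ u | inj₂ v = inj₂ (u , v)

∣_∣ℝ : ℝ → ℝ
∣ x ∣ℝ = x ⊔ℝ -ℝ x

-- n · x is the product nx, as an n-fold sum.
_·_ : ℕ → ℝ → ℝ
zero  · x = fromℚ 0ℚ
suc n · x = x +ℝ n · x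

-- Total: for x < 0 the cut below is that of 0.
√_ : ℝ → ℝ
√ x = record
  { L = λ q → q < 0ℚ ⊎ L x (q * q)
  ; U = λ q → 0ℚ < q × U x (q * q)
  ; L-inhabited = - 1ℚ , inj₁ (negative⁻¹ (- 1ℚ))
  ; U-inhabited = U-inh
  ; L-lower = L-low
  ; U-upper = λ { p<q (0<p , u) → <-trans 0<p p<q , U-upper x (square-mono-< (<⇒≤ 0<p) p<q) u }
  ; L-open = L-op
  ; U-open = U-op
  ; disjoint = λ { (inj₁ q<0) (0<q , _) → <-irrefl refl (<-trans q<0 0<q)
                 ; (inj₂ l) (_ , u) → disjoint x l u }
  ; located = loc
  }
  where
  U-inh : ∃ λ q → 0ℚ < q × U x (q * q)
  U-inh =
    let u , Uu = U-inhabited x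
        q , 0<q , u≤q² = ≤square u
    in q , 0<q , U-upper-≤ x u≤q² Uu

  L-low : ∀ {p q} → p < q → q < 0ℚ ⊎ L x (q * q) → p < 0ℚ ⊎ L x (p * p)
  L-low p<q (inj₁ q<0) = inj₁ (<-trans p<q q<0)
  L-low {p} p<q (inj₂ l) with p <? 0ℚ
  ... | yes p<0 = inj₁ p<0
  ... | no  p≮0 = inj₂ (L-lower x (square-mono-< (≮⇒≥ p≮0) p<q) l)

  L-op : ∀ {p} → p < 0ℚ ⊎ L x (p * p) → ∃ λ q → p < q × (q < 0ℚ ⊎ L x (q * q))
  L-op (inj₁ p<0) = map₂ (map₂ inj₁) (<-dense p<0)
  L-op {p} (inj₂ l) with p <? 0ℚ
  ... | yes p<0 = map₂ (map₂ inj₁) (<-dense p<0)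
  ... | no  p≮0 =
    let t , p²<t , l′ = L-open x l
        q , p<q , q²≤t = square-below p t (≮⇒≥ p≮0) p²<t
    in q , p<q , inj₂ (L-lower-≤ x q²≤t l′)

  U-op : ∀ {q} → 0ℚ < q × U x (q * q) → ∃ λ p → p < q × 0ℚ < p × U x (p * p)
  U-op {q} (0<q , u) =
    let t , t<q² , u′ = U-open x u
        p , p<q , 0<p , t≤p² = square-above q t 0<q t<q²
    in p , p<q , 0<p , U-upper-≤ x t≤p² u′

  loc : ∀ {p q} → p < q → (p < 0ℚ ⊎ L x (p * p)) ⊎ (0ℚ < q × U x (q * q))
  loc {p} p<q with p <? 0ℚ
  ... | yes p<0 = inj₁ (inj₁ p<0)
  ... | no  p≮0 = Sum.map inj₂ (≤-<-trans (≮⇒≥ p≮0) p<q ,_) (located x (square-mono-< (≮⇒≥ p≮0) p<q))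

record Finite (P : Pred ℕ 0ℓ) : Set where
  field
    elements : List ℕ
    unique   : Unique elements
    complete : ∀ {m} → m ∈ elements ⇔ P m

-- Independent of the enumeration, as two duplicate-free lists with the same
-- members are permutations of each other.
card : ∀ {P} → Finite P → ℕ
card = length ∘ Finite.elements

-- X ℕ./ n is ⌊ X / n ⌋.
S : ℕ → Pred ℕ 0ℓ
S X m = 0 ℕ.< m × ∃₂ λ n (n>0 : ℕ.NonZero n) → n ℕ.≤ X × m ≡ (X ℕ./ n) {{n>0}}

S-finite : ∀ X → Finite (S X)
S-finite X = record
  { elements = deduplicate ℕ._≟_ values
  ; unique   = Unique.deduplicate-! ℕ._≟_ values
  ; complete = mk⇔ (sound ∘ ∈-deduplicate⁻ ℕ._≟_ values) (∈-deduplicate⁺ ℕ._≟_ ∘ exhaustive)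
  }
  where
  quotient : ℕ → ℕ
  quotient k = X ℕ./ suc k

  values : List ℕ
  values = map quotient (upTo X)

  sound : ∀ {m} → m ∈ values → S X m
  sound m∈ with ∈-map⁻ quotient m∈
  ... | k , k∈ , refl = ℕ.m≥n⇒m/n>0 (∈-upTo⁻ k∈) , suc k , _ , ∈-upTo⁻ k∈ , refl

  exhaustive : ∀ {m} → S X m → m ∈ values
  exhaustive (_ , suc k , _ , n≤X , refl) = ∈-map⁺ quotient (∈-upTo⁺ n≤X)

∣S_∣ : ℕ → ℕ
∣S X ∣ = card (S-finite X)

{-# OPTIONS --safe #-}

-- Let r = ⌊√X⌋. The values ⌊X/n⌋ with n ≤ r are distinct and at least r, and
-- every m ≤ r is itself a value, as m = ⌊X/⌊X/m⌋⌋. A value exceeding r comes from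
-- some n ≤ r. Hence 2r − 1 ≤ |S(X)| ≤ 2r, while 2r ≤ 2√X < 2r + 2.
module Submission where

open import Defs
open import Algebra.Properties.Group using (⁻¹-involutive)
open import Data.Integer as ℤ using (+_)
import Data.Integer.Properties as ℤ
open import Data.List using (List; []; _∷_; _++_; length; applyUpTo)
open import Data.List.Membership.Propositional using (_∈_)
open import Data.List.Membership.Propositional.Properties
  using (∈-∃++; ∈-++⁺ˡ; ∈-++⁺ʳ; ∈-++⁻; ∈-applyUpTo⁺; ∈-applyUpTo⁻)
open import Data.List.Properties using (length-++; length-applyUpTo)
open import Data.List.Relation.Binary.Permutation.Propositional.Properties using (shift; ↭-length)
open import Data.List.Relation.Binary.Subset.Propositional using (_⊆_)
open import Data.List.Relation.Binary.Subset.Propositional.Properties using (⊆-respʳ-↭; ⊆∷∧∉⇒⊆)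
open import Data.List.Relation.Unary.AllPairs using (tail)
open import Data.List.Relation.Unary.Any using (here; there)
open import Data.List.Relation.Unary.Unique.Propositional using (Unique)
open import Data.List.Relation.Unary.Unique.Propositional.Properties
  using (Unique[x∷xs]⇒x∉xs; applyUpTo⁺₁) renaming (++⁺ to Unique-++⁺)
open import Data.Nat using (ℕ; zero; suc; pred; NonZero; z≤n; s≤s; z<s; >-nonZero)
import Data.Nat as ℕ
import Data.Nat.DivMod as ℕ
import Data.Nat.Properties as ℕ
open import Data.Product using (∃; _×_; _,_)
open import Data.Rational hiding (NonZero; >-nonZero)
open import Data.Rational.Properties
import Data.Rational.Unnormalised as ℚᵘ
import Data.Rational.Unnormalised.Properties as ℚᵘ
open import Data.Sum using (inj₁; inj₂)
open import Function using (_∘_; Equivalence)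
open import Level using (0ℓ)
open import Relation.Binary.PropositionalEquality
open import Relation.Nullary using (yes; no; ¬_)
open import Relation.Unary using (Pred)

-- Cardinality bounds from duplicate-free lists.

-- Induction on `xs`: an occurrence of the head `x` in `ys` is moved to the front by a permutation.
-- By uniqueness the tail avoids `x`, so it lies in `zs ++ ws`, which is one shorter than `ys`.
unique-⊆⇒length≤ : ∀ {A : Set} {xs ys : List A} → Unique xs → xs ⊆ ys → length xs ℕ.≤ length ys
unique-⊆⇒length≤ {xs = []} _ _ = z≤n
unique-⊆⇒length≤ {xs = x ∷ xs} u xs⊆ys with ∈-∃++ (xs⊆ys (here refl))
... | zs , ws , refl = subst (suc (length xs) ℕ.≤_) (sym (↭-length (shift x zs ws)))
  (s≤s (unique-⊆⇒length≤ (tail u)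
    (⊆∷∧∉⇒⊆ (⊆-respʳ-↭ (shift x zs ws) (xs⊆ys ∘ there)) (Unique[x∷xs]⇒x∉xs u))))

module _ {P : Pred ℕ 0ℓ} (F : Finite P) where

  open Finite F

  card≤length : ∀ {xs} → (∀ {m} → P m → m ∈ xs) → card F ℕ.≤ length xs
  card≤length P⊆xs = unique-⊆⇒length≤ unique (P⊆xs ∘ Equivalence.to complete)

  length≤card : ∀ {xs} → Unique xs → (∀ {m} → m ∈ xs → P m) → length xs ℕ.≤ card F
  length≤card u xs⊆P = unique-⊆⇒length≤ u (Equivalence.from complete ∘ xs⊆P)

-- Integer square root and floor quotients.

√-bracket : ∀ X → ∃ λ r → r ℕ.* r ℕ.≤ X × X ℕ.< suc r ℕ.* suc r
√-bracket zero = 0 , z≤n , z<s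
√-bracket (suc X) with √-bracket X
... | r , r²≤X , X<[1+r]² with suc X ℕ.<? suc r ℕ.* suc r
... | yes 1+X<[1+r]² = r , ℕ.m≤n⇒m≤1+n r²≤X , 1+X<[1+r]²
-- The root advances by one; `X<[1+r]²` unfolds to `suc X ≤ (r+1)²`, and `(r+1)² < (r+2)²`.
... | no  1+X≮[1+r]² = suc r , ℕ.≮⇒≥ 1+X≮[1+r]² ,
  ℕ.≤-<-trans X<[1+r]² (ℕ.*-mono-< (ℕ.n<1+n (suc r)) (ℕ.n<1+n (suc r)))

m*n≤o⇒m≤o/n : ∀ m n {o} .{{_ : NonZero n}} → m ℕ.* n ℕ.≤ o → m ℕ.≤ o ℕ./ n
m*n≤o⇒m≤o/n m n m*n≤o = subst (ℕ._≤ _) (ℕ.m*n/n≡m m n) (ℕ./-monoˡ-≤ n m*n≤o)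

m<[1+m/n]*n : ∀ m n .{{_ : NonZero n}} → m ℕ.< suc (m ℕ./ n) ℕ.* n
m<[1+m/n]*n m n = ℕ.≰⇒> λ le → ℕ.1+n≰n (m*n≤o⇒m≤o/n _ n le)

module _ {X r : ℕ} (r²≤X : r ℕ.* r ℕ.≤ X) where

  r≤X/n : ∀ {n} .{{_ : NonZero n}} → n ℕ.≤ r → r ℕ.≤ X ℕ./ n
  r≤X/n {n} n≤r = m*n≤o⇒m≤o/n r n (ℕ.≤-trans (ℕ.*-monoʳ-≤ r n≤r) r²≤X)

  -- With `k = X / n` one has `m < n ≤ r ≤ k`, so `(k+1)m = m + km ≤ k + km = k(m+1) ≤ kn ≤
  -- X`, hence `k+1 ≤ X / m`.
  /-strictly-antitone : ∀ {m n} .{{_ : NonZero m}} .{{_ : NonZero n}} →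
                        m ℕ.< n → n ℕ.≤ r → X ℕ./ n ℕ.< X ℕ./ m
  /-strictly-antitone {m} {n} m<n n≤r = m*n≤o⇒m≤o/n _ m (begin
    m ℕ.+ k ℕ.* m  ≤⟨ ℕ.+-monoˡ-≤ _ (ℕ.≤-trans (ℕ.<⇒≤ m<n) (ℕ.≤-trans n≤r (r≤X/n n≤r))) ⟩
    k ℕ.+ k ℕ.* m  ≡⟨ ℕ.*-suc k m ⟨
    k ℕ.* suc m    ≤⟨ ℕ.*-monoʳ-≤ k m<n ⟩
    k ℕ.* n        ≤⟨ ℕ.m/n*n≤m X n ⟩
    X              ∎)
    where
    open ℕ.≤-Reasoning
    k = X ℕ./ n

  r≤X : r ℕ.≤ X
  r≤X = ℕ.≤-trans (m≤m*m r) r²≤X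
    where
    m≤m*m : ∀ m → m ℕ.≤ m ℕ.* m
    m≤m*m zero      = z≤n
    m≤m*m m@(suc _) = ℕ.m≤m*n m m

  -- Put `q = X / m`. From `qm ≤ X` follows `m ≤ X / q`. Conversely `m ≤ r ≤ q` gives
  -- `X < (q+1)m = m + qm ≤ q + mq = (m+1)q`, so `X / q < m+1`.
  X/[X/m]≡m : ∀ {m} .{{_ : NonZero m}} .{{_ : NonZero (X ℕ./ m)}} →
              m ℕ.≤ r → X ℕ./ (X ℕ./ m) ≡ m
  X/[X/m]≡m {m} m≤r = ℕ.≤-antisym
    (ℕ.s≤s⁻¹ (ℕ.m<n*o⇒m/o<n (begin-strict
      X              <⟨ m<[1+m/n]*n X m ⟩
      m ℕ.+ q ℕ.* m  ≤⟨ ℕ.+-monoˡ-≤ _ (ℕ.≤-trans m≤r (r≤X/n m≤r)) ⟩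
      q ℕ.+ q ℕ.* m  ≡⟨ cong (q ℕ.+_) (ℕ.*-comm q m) ⟩
      q ℕ.+ m ℕ.* q  ∎)))
    (m*n≤o⇒m≤o/n m q (subst (ℕ._≤ X) (ℕ.*-comm q m) (ℕ.m/n*n≤m X m)))
    where
    open ℕ.≤-Reasoning
    q = X ℕ./ m

  quotient∈S : ∀ {n} .{{_ : NonZero n}} → n ℕ.≤ X → S X (X ℕ./ n)
  quotient∈S {suc n} n≤X = ℕ.m≥n⇒m/n>0 n≤X , suc n , _ , n≤X , refl

  small∈S : ∀ {m} .{{_ : NonZero m}} → m ℕ.≤ r → S X m
  small∈S {m} m≤r = subst (S X) (X/[X/m]≡m m≤r) (quotient∈S (ℕ.m/n≤m X m))
    where instance _ = >-nonZero (ℕ.m≥n⇒m/n>0 (ℕ.≤-trans m≤r r≤X))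

  -- Two-sided bound for the number of quotients.

  -- The list `large` stops at `n = r-1` because `X / r` may equal `r` (as for `X = r²`), which is
  -- already in `small`. This costs the `suc` on the right.
  lower-bound : r ℕ.+ r ℕ.≤ suc ∣S X ∣
  lower-bound = begin
    r ℕ.+ r                             ≤⟨ r+r≤1+[r+pred[r]] r ⟩
    suc (r ℕ.+ pred r)                  ≡⟨ cong suc (cong₂ ℕ._+_ (length-applyUpTo suc r) (length-applyUpTo quotient (pred r))) ⟨
    suc (length small ℕ.+ length large) ≡⟨ cong suc (length-++ small) ⟨
    suc (length (small ++ large))       ≤⟨ s≤s (length≤card (S-finite X) distinct values) ⟩
    suc ∣S X ∣                          ∎
    where
    open ℕ.≤-Reasoning
    quotient : ℕ → ℕ
    quotient k = X ℕ./ suc k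

    small large : List ℕ
    small = applyUpTo suc r
    large = applyUpTo quotient (pred r)

    r+r≤1+[r+pred[r]] : ∀ r → r ℕ.+ r ℕ.≤ suc (r ℕ.+ pred r)
    r+r≤1+[r+pred[r]] zero    = z≤n
    r+r≤1+[r+pred[r]] (suc r) = ℕ.≤-reflexive (ℕ.+-suc (suc r) r)

    k<pred[n]⇒1+k<n : ∀ {k} n → k ℕ.< pred n → suc k ℕ.< n
    k<pred[n]⇒1+k<n (suc n) = s≤s

    distinct : Unique (small ++ large)
    distinct = Unique-++⁺
      (applyUpTo⁺₁ suc r λ i<j _ → ℕ.<⇒≢ (s≤s i<j))
      (applyUpTo⁺₁ quotient (pred r) λ i<j j<r-1 →
        ℕ.>⇒≢ (/-strictly-antitone (s≤s i<j) (ℕ.<⇒≤ (k<pred[n]⇒1+k<n r j<r-1))))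
      λ (m∈small , m∈large) → large∌small m∈small m∈large
      where
      large∌small : ∀ {m} → m ∈ small → ¬ m ∈ large
      large∌small m∈small m∈large with ∈-applyUpTo⁻ suc m∈small | ∈-applyUpTo⁻ quotient m∈large
      -- As `k+2 ≤ r`, the entry satisfies `X / (k+1) > X / (k+2) ≥ r`.
      ... | _ , m≤r , refl | k , k<r-1 , eq = ℕ.<⇒≱
        (ℕ.≤-<-trans (r≤X/n 2+k≤r) (/-strictly-antitone (ℕ.n<1+n (suc k)) 2+k≤r))
        (subst (ℕ._≤ r) eq m≤r)
        where 2+k≤r = k<pred[n]⇒1+k<n r k<r-1

    values : ∀ {m} → m ∈ small ++ large → S X m
    values m∈ with ∈-++⁻ small m∈
    ... | inj₁ m∈small with ∈-applyUpTo⁻ suc m∈small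
    ...   | _ , m≤r , refl = small∈S m≤r
    values m∈ | inj₂ m∈large with ∈-applyUpTo⁻ quotient m∈large
    ...   | k , k<r-1 , refl = quotient∈S (ℕ.≤-trans (ℕ.<⇒≤ (k<pred[n]⇒1+k<n r k<r-1)) r≤X)

-- Here `large` runs up to `n = r`; it may overlap `small`, since `card≤length` asks only for a
-- covering list.
upper-bound : ∀ {X r} → X ℕ.< suc r ℕ.* suc r → ∣S X ∣ ℕ.≤ r ℕ.+ r
upper-bound {X} {r} X<[1+r]² = begin
  ∣S X ∣                        ≤⟨ card≤length (S-finite X) covered ⟩
  length (small ++ large)       ≡⟨ length-++ small ⟩
  length small ℕ.+ length large ≡⟨ cong₂ ℕ._+_ (length-applyUpTo suc r) (length-applyUpTo quotient r) ⟩
  r ℕ.+ r                       ∎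
  where
  open ℕ.≤-Reasoning
  quotient : ℕ → ℕ
  quotient k = X ℕ./ suc k

  small large : List ℕ
  small = applyUpTo suc r
  large = applyUpTo quotient r

  covered : ∀ {m} → S X m → m ∈ small ++ large
  covered {suc m} (_ , suc k , _ , _ , eq) with m ℕ.<? r
  ... | yes m<r = ∈-++⁺ˡ (∈-applyUpTo⁺ suc m<r)
  -- The value is `m+1 ≥ r+1`, so with `n = k+1`, `(r+1)n ≤ (m+1)n ≤ X < (r+1)²`; cancelling `r+1`
  -- leaves `n ≤ r`.
  ... | no  m≮r = ∈-++⁺ʳ small (subst (_∈ large) (sym eq) (∈-applyUpTo⁺ quotient
    (ℕ.s<s⁻¹ (ℕ.*-cancelˡ-< (suc r) (suc k) (suc r) (begin-strict
      suc r ℕ.* suc k       ≤⟨ ℕ.*-monoˡ-≤ (suc k) (s≤s (ℕ.≮⇒≥ m≮r)) ⟩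
      suc m ℕ.* suc k       ≡⟨ cong (ℕ._* suc k) eq ⟩
      quotient k ℕ.* suc k  ≤⟨ ℕ.m/n*n≤m X (suc k) ⟩
      X                     <⟨ X<[1+r]² ⟩
      suc r ℕ.* suc r       ∎)))))

-- Naturals inside the rationals.

infix 9 _/1

-- The rational inside `fromℕ n`, so membership in the cuts of `fromℕ n` is comparison with `n /1`.
_/1 : ℕ → ℚ
n /1 = + n / 1

-- `+ n / 1` is normalised through a gcd; the unnormalised form has denominator 1, where order and
-- arithmetic reduce to those of the integers.
toℚᵘ-/1 : ∀ n → toℚᵘ (n /1) ℚᵘ.≃ ℚᵘ.mkℚᵘ (+ n) 0
toℚᵘ-/1 n = toℚᵘ-fromℚᵘ (ℚᵘ.mkℚᵘ (+ n) 0)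

/1-mono-≤ : ∀ {m n} → m ℕ.≤ n → m /1 ≤ n /1
/1-mono-≤ {m} {n} m≤n = toℚᵘ-cancel-≤
  (ℚᵘ.≤-respˡ-≃ (ℚᵘ.≃-sym (toℚᵘ-/1 m)) (ℚᵘ.≤-respʳ-≃ (ℚᵘ.≃-sym (toℚᵘ-/1 n))
    (ℚᵘ.*≤* (ℤ.*-monoʳ-≤-nonNeg (+ 1) (ℤ.+≤+ m≤n)))))

/1-mono-< : ∀ {m n} → m ℕ.< n → m /1 < n /1
/1-mono-< {m} {n} m<n = toℚᵘ-cancel-<
  (ℚᵘ.<-respˡ-≃ (ℚᵘ.≃-sym (toℚᵘ-/1 m)) (ℚᵘ.<-respʳ-≃ (ℚᵘ.≃-sym (toℚᵘ-/1 n))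
    (ℚᵘ.*<* (ℤ.*-monoʳ-<-pos (+ 1) (ℤ.+<+ m<n)))))

/1-homo-+ : ∀ m n → (m ℕ.+ n) /1 ≡ m /1 + n /1
/1-homo-+ m n = toℚᵘ-injective (begin
  toℚᵘ ((m ℕ.+ n) /1)                        ≈⟨ toℚᵘ-/1 (m ℕ.+ n) ⟩
  ℚᵘ.mkℚᵘ (+ (m ℕ.+ n)) 0                    ≈⟨ ℚᵘ.*≡* (cong (ℤ._* + 1) (sym (cong₂ ℤ._+_ (ℤ.*-identityʳ (+ m)) (ℤ.*-identityʳ (+ n))))) ⟩
  ℚᵘ.mkℚᵘ (+ m) 0 ℚᵘ.+ ℚᵘ.mkℚᵘ (+ n) 0       ≈⟨ ℚᵘ.+-cong (toℚᵘ-/1 m) (toℚᵘ-/1 n) ⟨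
  toℚᵘ (m /1) ℚᵘ.+ toℚᵘ (n /1)               ≈⟨ toℚᵘ-homo-+ (m /1) (n /1) ⟨
  toℚᵘ (m /1 + n /1)                         ∎)
  where open ℚᵘ.≃-Reasoning

/1-homo-* : ∀ m n → (m ℕ.* n) /1 ≡ m /1 * n /1
/1-homo-* m n = toℚᵘ-injective (begin
  toℚᵘ ((m ℕ.* n) /1)                        ≈⟨ toℚᵘ-/1 (m ℕ.* n) ⟩
  ℚᵘ.mkℚᵘ (+ (m ℕ.* n)) 0                    ≈⟨ ℚᵘ.*≡* (cong (ℤ._* + 1) (ℤ.pos-* m n)) ⟩
  ℚᵘ.mkℚᵘ (+ m) 0 ℚᵘ.* ℚᵘ.mkℚᵘ (+ n) 0       ≈⟨ ℚᵘ.*-cong (toℚᵘ-/1 m) (toℚᵘ-/1 n) ⟨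
  toℚᵘ (m /1) ℚᵘ.* toℚᵘ (n /1)               ≈⟨ toℚᵘ-homo-* (m /1) (n /1) ⟨
  toℚᵘ (m /1 * n /1)                         ∎)
  where open ℚᵘ.≃-Reasoning

square-mono-≤ : ∀ {p q} → 0ℚ ≤ p → p ≤ q → p * p ≤ q * q
square-mono-≤ {p} {q} 0≤p p≤q = ≤-trans
  (*-monoˡ-≤-nonNeg p {{nonNegative 0≤p}} p≤q)
  (*-monoʳ-≤-nonNeg q {{nonNegative (≤-trans 0≤p p≤q)}} p≤q)

-- Rational bounds on the cuts of `2 · √ fromℕ X`.

open ℝ

module _ {X s : ℕ} (X<s² : X ℕ.< s ℕ.* s) where

  L√⇒< : ∀ {q} → L (√ fromℕ X) q → q < s /1
  L√⇒< (inj₁ q<0) = <-≤-trans q<0 (/1-mono-≤ {n = s} z≤n)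
  -- If `s ≤ q`, then `s² ≤ q² < X < s²`.
  L√⇒< {q} (inj₂ q²<X) = ≰⇒> λ s≤q → <-asym q²<X (<-≤-trans (/1-mono-< X<s²)
    (≤-trans (≤-reflexive (/1-homo-* s s)) (square-mono-≤ (/1-mono-≤ {n = s} z≤n) s≤q)))

  L2√⇒< : ∀ {q} → L (2 · √ fromℕ X) q → q < (s ℕ.+ s) /1
  -- `2 · x` unfolds to `x + (x + 0)`, so a member of its lower cut is a sum of three rationals, the
  -- last one negative.
  L2√⇒< (a , _ , a<√X , (b , c , b<√X , c<0 , refl) , refl) = begin-strict
    a + (b + c)          <⟨ +-mono-< (L√⇒< a<√X) (+-mono-< (L√⇒< b<√X) c<0) ⟩
    s /1 + (s /1 + 0ℚ)   ≡⟨ cong (s /1 +_) (+-identityʳ (s /1)) ⟩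
    s /1 + s /1          ≡⟨ /1-homo-+ s s ⟨
    (s ℕ.+ s) /1         ∎
    where open ≤-Reasoning

module _ {X r : ℕ} (r²≤X : r ℕ.* r ℕ.≤ X) where

  U√⇒> : ∀ {q} → U (√ fromℕ X) q → r /1 < q
  -- If `q ≤ r`, then `q² ≤ r² ≤ X < q²`.
  U√⇒> {q} (0<q , X<q²) = ≰⇒> λ q≤r → <-irrefl refl (<-≤-trans X<q² (≤-trans (square-mono-≤ (<⇒≤ 0<q) q≤r)
    (≤-trans (≤-reflexive (sym (/1-homo-* r r))) (/1-mono-≤ r²≤X))))

  U2√⇒> : ∀ {q} → U (2 · √ fromℕ X) q → (r ℕ.+ r) /1 < q
  U2√⇒> (a , _ , √X<a , (b , c , √X<b , 0<c , refl) , refl) = begin-strict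
    (r ℕ.+ r) /1         ≡⟨ /1-homo-+ r r ⟩
    r /1 + r /1          ≡⟨ cong (r /1 +_) (+-identityʳ (r /1)) ⟨
    r /1 + (r /1 + 0ℚ)   <⟨ +-mono-< (U√⇒> √X<a) (+-mono-< (U√⇒> √X<b) 0<c) ⟩
    a + (b + c)          ∎
    where open ≤-Reasoning

-- From integer inequalities to the real estimate.

difference< : ∀ i j k {p q} → i ℕ.≤ k ℕ.+ j → p < i /1 → j /1 < q → p - q < k /1
difference< i j k {p} {q} i≤k+j p<i j<q = begin-strict
  p - q                  <⟨ +-mono-< p<i (neg-antimono-< j<q) ⟩
  i /1 - j /1            ≤⟨ +-monoˡ-≤ (- j /1) (/1-mono-≤ i≤k+j) ⟩
  (k ℕ.+ j) /1 - j /1    ≡⟨ cong (_- j /1) (/1-homo-+ k j) ⟩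
  k /1 + j /1 - j /1     ≡⟨ +-assoc (k /1) (j /1) (- j /1) ⟩
  k /1 + (j /1 - j /1)   ≡⟨ cong (k /1 +_) (+-inverseʳ (j /1)) ⟩
  k /1 + 0ℚ              ≡⟨ +-identityʳ (k /1) ⟩
  k /1                   ∎
  where open ≤-Reasoning

theorem1p2 : ∃ λ (C : ℝ) → (X : ℕ) → .{{_ : NonZero X}} → ∣ fromℕ ∣S X ∣ -ℝ 2 · √ fromℕ X ∣ℝ ≤ℝ C
-- With `N = ∣S X ∣`: `2√X < 2r+2` and `N ≥ 2r-1` give `2√X - N < 3`, while `N ≤ 2r ≤ 2√X` settles
-- the other sign.
theorem1p2 = fromℕ 3 , bound
  where
  bound : ∀ X → .{{_ : NonZero X}} → ∣ fromℕ ∣S X ∣ -ℝ 2 · √ fromℕ X ∣ℝ ≤ℝ fromℕ 3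
  bound X {q} l with √-bracket X | l
  -- The absolute value is a maximum, so its lower cut is a disjunction. Here `q = a + b` lies below
  -- `N - 2√X`, and is read as `a - (- b)` with `2√X < - b`.
  ... | r , r²≤X , X<[1+r]² | inj₁ (a , b , a<N , 2√X<-b , refl) =
    subst (λ c → a + c < 3 /1) (⁻¹-involutive +-0-group b)
      (difference< ∣S X ∣ (r ℕ.+ r) 3 (ℕ.m≤n⇒m≤o+n 3 (upper-bound {r = r} X<[1+r]²))
        a<N (U2√⇒> {r = r} r²≤X 2√X<-b))
  -- Here `q` lies below the negated difference, that is, `- q` lies above `N - 2√X`; hence
  -- `q = - b - a` with `- b < 2√X` and `N < a`.
  ... | r , r²≤X , X<[1+r]² | inj₂ (a , b , N<a , -b<2√X , -q≡a+b) =
    subst (_< 3 /1) (q≡-b-a -q≡a+b)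
      (difference< (suc r ℕ.+ suc r) ∣S X ∣ 3 (2[1+r]≤3+N (lower-bound {r = r} r²≤X))
        (L2√⇒< {s = suc r} X<[1+r]² -b<2√X) N<a)
    where
    2[1+r]≤3+N : ∀ {N} → r ℕ.+ r ℕ.≤ suc N → suc r ℕ.+ suc r ℕ.≤ 3 ℕ.+ N
    2[1+r]≤3+N r+r≤1+N = s≤s (ℕ.≤-trans (ℕ.≤-reflexive (ℕ.+-suc r r)) (s≤s r+r≤1+N))

    q≡-b-a : - q ≡ a + b → - b - a ≡ q
    q≡-b-a -q≡a+b = begin
      - b - a    ≡⟨ +-comm (- b) (- a) ⟩
      - a - b    ≡⟨ neg-distrib-+ a b ⟨
      - (a + b)  ≡⟨ cong -_ -q≡a+b ⟨
      - (- q)    ≡⟨ ⁻¹-involutive +-0-group q ⟩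
      q          ∎
      where open ≡-Reasoning
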